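{- Let $G$ be a finite simple graph consisting of $m\ge 1$ connected components $G_1,\ldots,G_m$, let $n=|V(G)|$, and for $1\le i\le m$ let $b_i=n-|V(G_i)|$. Then $$\widetilde{D}(G,x)=\Big(\sum_{i=1}^m x^{b_i}\,\widetilde{D}(G_i,x)\Big)-(m-1)x^n,$$ where $\widetilde{D}$ denotes the outer-connected domination polynomial.
   Context: All graphs are finite, simple, and have nonempty vertex set. A set $S\subseteq V(G)$ is a dominating set of $G$ if every vertex of $V(G)\setminus S$ is adjacent to at least one vertex of $S$. A set $S\subseteq V(G)$ is an outer-connected dominating set (ocd-set) of $G$ if $S$ is a dominating set of $G$ and either $S=V(G)$ or the subgraph of $G$ induced by $V(G)\setminus S$ is connected. The outer-connected domination number $\widetilde{\gamma}_c(G)$ is the minimum cardinality of an ocd-set of $G$. Let $\widetilde{d}(G,i)$ be the number of ocd-sets of $G$ of cardinality $i$. The outer-connected domination polynomial of $G$ is $\widetilde{D}(G,x)=\sum_{i=\widetilde{\gamma}_c(G)}^{|V(G)|}\widetilde{d}(G,i)\,x^i$. -}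

module Defs where

open import Data.Bool.Properties using () renaming (_≟_ to _≟ᵇ_)
open import Data.Fin.Base using (Fin)
open import Data.Fin.Properties using (any?; all?)
open import Data.Fin.Subset using (Subset; inside; outside; _∈_; _∉_; _⊆_; _⊃_; _∪_; _─_; ⁅_⁆; ∣_∣; Nonempty)
open import Data.Fin.Subset.Induction using (Acc; acc; ⊃-wellFounded)
open import Data.Fin.Subset.Properties using (_∈?_; _⊆?_; nonempty?; x∈⁅x⁆; x∈⁅y⁆⇒x≡y; p⊆p∪q; q⊆p∪q; x∈p∪q⁻; p─q⊆p)
open import Data.Integer.Base as ℤ using (ℤ; +_; 0ℤ)
open import Data.List.Base using (List; []; _∷_; _++_; map; filter; foldr; length; replicate; applyUpTo)
open import Data.List.Extrema.Nat using (min)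
open import Data.Nat.Base as ℕ using (ℕ; zero; suc; _∸_)
open import Data.Nat.Properties using () renaming (_≟_ to _≟ⁿ_)
open import Data.Product.Base using (Σ-syntax; ∃-syntax; _×_; _,_)
open import Data.Sum.Base using (_⊎_; inj₁; inj₂)
import Data.Vec.Base as Vec
open import Data.Vec.Properties using () renaming (≡-dec to Vec-≡-dec)
open import Function.Definitions using (Injective)
open import Level using (0ℓ)
open import Relation.Binary.Construct.Closure.ReflexiveTransitive using (Star; ε; _◅_; _◅◅_)
open import Relation.Binary.Core using (Rel)
open import Relation.Binary.Definitions using (Decidable; Symmetric; Irreflexive)
open import Relation.Binary.PropositionalEquality.Core using (_≡_; refl)
open import Relation.Nullary using (Dec; yes; no; contradiction)
open import Relation.Nullary.Decidable using (map′; ¬?; _×-dec_; _⊎-dec_; _→-dec_)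

------------------------------------------------------------------------
-- Finite simple graphs

-- The vertex set is a subset of an ambient Fin N, rather than Fin N
-- itself, so that a graph and its subgraphs have the same type.
record Graph (N : ℕ) : Set₁ where
  field
    V        : Subset N
    nonempty : Nonempty V
    _~_      : Rel (Fin N) 0ℓ
    _~?_     : Decidable _~_
    ~-sym    : Symmetric _~_
    ~-irrefl : Irreflexive _≡_ _~_
    ~⇒∈      : ∀ {u v} → u ~ v → u ∈ V

open Graph public using (V)

order : ∀ {N} → Graph N → ℕ
order G = ∣ V G ∣

induced : ∀ {N} (G : Graph N) (S : Subset N) → S ⊆ V G → Nonempty S → Graph N
induced G S S⊆V ne = record
  { V        = S
  ; nonempty = ne
  ; _~_      = λ u v → u ∈ S × v ∈ S × u ~ v
  ; _~?_     = λ u v → u ∈? S ×-dec v ∈? S ×-dec u ~? v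
  ; ~-sym    = λ { (u∈S , v∈S , u~v) → v∈S , u∈S , ~-sym u~v }
  ; ~-irrefl = λ { u≡v (_ , _ , u~v) → ~-irrefl u≡v u~v }
  ; ~⇒∈      = λ { (u∈S , _) → u∈S }
  }
  where open Graph G using (_~_; _~?_; ~-sym; ~-irrefl)

Connected : ∀ {N} → Graph N → Set
Connected G = ∀ u v → u ∈ V G → v ∈ V G → Star (Graph._~_ G) u v

infix 4 _≤ᴳ_ _≈ᴳ_

_≤ᴳ_ : ∀ {N} → Graph N → Graph N → Set
H ≤ᴳ G = V H ⊆ V G × (∀ u v → Graph._~_ H u v → Graph._~_ G u v)

-- Two graphs are identified when they have the same vertices and edges.
_≈ᴳ_ : ∀ {N} → Graph N → Graph N → Set
G ≈ᴳ H = G ≤ᴳ H × H ≤ᴳ G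

-- A connected component is a maximal connected subgraph.
record IsComponent {N : ℕ} (G H : Graph N) : Set₁ where
  field
    subgraph  : H ≤ᴳ G
    connected : Connected H
    maximal   : ∀ K → K ≤ᴳ G → Connected K → H ≤ᴳ K → K ≤ᴳ H

-- The family lists all components of G, each exactly once.
record AreComponents {N m : ℕ} (G : Graph N) (Gᵢ : Fin m → Graph N) : Set₁ where
  field
    component : ∀ i → IsComponent G (Gᵢ i)
    distinct  : Injective _≡_ _≈ᴳ_ Gᵢ
    complete  : ∀ H → IsComponent G H → ∃[ i ] H ≈ᴳ Gᵢ i

------------------------------------------------------------------------
-- Outer-connected dominating sets

Dominating : ∀ {N} → Graph N → Subset N → Set
Dominating G S = ∀ v → v ∈ V G → v ∉ S → ∃[ u ] u ∈ S × Graph._~_ G v u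

OuterConnected : ∀ {N} → Graph N → Subset N → Set
OuterConnected G S = S ≡ V G ⊎
  (Σ[ ne ∈ Nonempty (V G ─ S) ] Connected (induced G (V G ─ S) (p─q⊆p (V G) S) ne))

IsOCD : ∀ {N} → Graph N → Subset N → Set
IsOCD G S = S ⊆ V G × Dominating G S × OuterConnected G S

------------------------------------------------------------------------
-- Decidability, needed in order to count ocd-sets

module _ {N : ℕ} {R : Rel (Fin N) 0ℓ} (R? : Decidable R) where

  private
    closed⇒Star⊆ : ∀ (S : Subset N) → (∀ {x y} → x ∈ S → R x y → y ∈ S) →
                   ∀ {x y} → x ∈ S → Star R x y → y ∈ S
    closed⇒Star⊆ S cl x∈S ε        = x∈S
    closed⇒Star⊆ S cl x∈S (r ◅ rs) = closed⇒Star⊆ S cl (cl x∈S r) rs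

    -- Enlarge a set S of points reachable from u until it is closed under R.
    grow : ∀ u v (S : Subset N) → Acc _⊃_ S → u ∈ S →
           (∀ {x} → x ∈ S → Star R u x) → Dec (Star R u v)
    grow u v S (acc rec) u∈S reach
      with any? (λ x → any? (λ y → x ∈? S ×-dec ¬? (y ∈? S) ×-dec R? x y))
    ... | yes (x , y , x∈S , y∉S , xRy) =
      grow u v (S ∪ ⁅ y ⁆)
        (rec (p⊆p∪q ⁅ y ⁆ , y , q⊆p∪q S ⁅ y ⁆ (x∈⁅x⁆ y) , y∉S))
        (p⊆p∪q ⁅ y ⁆ u∈S) reach′
      where
      reach′ : ∀ {z} → z ∈ S ∪ ⁅ y ⁆ → Star R u z
      reach′ z∈ with x∈p∪q⁻ S ⁅ y ⁆ z∈
      ... | inj₁ z∈S = reach z∈S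
      ... | inj₂ z∈y with refl ← x∈⁅y⁆⇒x≡y y z∈y = reach x∈S ◅◅ xRy ◅ ε
    ... | no ¬exit = map′ reach (closed⇒Star⊆ S closed u∈S) (v ∈? S)
      where
      closed : ∀ {x y} → x ∈ S → R x y → y ∈ S
      closed {x} {y} x∈S xRy with y ∈? S
      ... | yes y∈S = y∈S
      ... | no  y∉S = contradiction (x , y , x∈S , y∉S , xRy) ¬exit

  star? : Decidable (Star R)
  star? u v = grow u v ⁅ u ⁆ (⊃-wellFounded ⁅ u ⁆) (x∈⁅x⁆ u) reach
    where
    reach : ∀ {x} → x ∈ ⁅ u ⁆ → Star R u x
    reach x∈u with refl ← x∈⁅y⁆⇒x≡y u x∈u = ε

connected? : ∀ {N} (G : Graph N) → Dec (Connected G)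
connected? G = all? λ u → all? λ v →
  u ∈? V G →-dec v ∈? V G →-dec star? (Graph._~?_ G) u v

dominating? : ∀ {N} (G : Graph N) (S : Subset N) → Dec (Dominating G S)
dominating? G S = all? λ v →
  v ∈? V G →-dec ¬? (v ∈? S) →-dec any? λ u → u ∈? S ×-dec Graph._~?_ G v u

outerConnected? : ∀ {N} (G : Graph N) (S : Subset N) → Dec (OuterConnected G S)
outerConnected? G S = Vec-≡-dec _≟ᵇ_ S (V G) ⊎-dec rest
  where
  rest : Dec (Σ[ ne ∈ Nonempty (V G ─ S) ]
              Connected (induced G (V G ─ S) (p─q⊆p (V G) S) ne))
  rest with nonempty? (V G ─ S)
  ... | no ¬ne = no λ { (ne , _) → ¬ne ne }
  ... | yes ne = map′ (ne ,_) (λ { (_ , c) → c })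
                   (connected? (induced G (V G ─ S) (p─q⊆p (V G) S) ne))

isOCD? : ∀ {N} (G : Graph N) (S : Subset N) → Dec (IsOCD G S)
isOCD? G S = S ⊆? V G ×-dec dominating? G S ×-dec outerConnected? G S

------------------------------------------------------------------------
-- Polynomials with integer coefficients

-- Constant coefficient first; trailing zeros are allowed, so equality of
-- polynomials is _≈ₚ_ and not _≡_.
Poly : Set
Poly = List ℤ

coeff : Poly → ℕ → ℤ
coeff []      _       = 0ℤ
coeff (a ∷ p) zero    = a
coeff (a ∷ p) (suc k) = coeff p k

infix  4 _≈ₚ_
infixl 6 _+ₚ_ _-ₚ_
infixl 7 _*ₚ_
infix  8 _X^_

_≈ₚ_ : Rel Poly 0ℓ
p ≈ₚ q = ∀ k → coeff p k ≡ coeff q k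

_+ₚ_ : Poly → Poly → Poly
[]      +ₚ q       = q
(a ∷ p) +ₚ []      = a ∷ p
(a ∷ p) +ₚ (b ∷ q) = (a ℤ.+ b) ∷ (p +ₚ q)

_-ₚ_ : Poly → Poly → Poly
p -ₚ q = p +ₚ map ℤ.-_ q

_*ₚ_ : Poly → Poly → Poly
[]      *ₚ q = []
(a ∷ p) *ₚ q = map (a ℤ.*_) q +ₚ (0ℤ ∷ p *ₚ q)

-- The monomial c xᵏ.
_X^_ : ℤ → ℕ → Poly
c X^ k = replicate k 0ℤ ++ c ∷ []

∑ : List Poly → Poly
∑ = foldr _+ₚ_ []

------------------------------------------------------------------------
-- The outer-connected domination polynomial

subsets : ∀ N → List (Subset N)
subsets zero    = Vec.[] ∷ []
subsets (suc N) = map (outside Vec.∷_) (subsets N) ++ map (inside Vec.∷_) (subsets N)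

ocdSets : ∀ {N} → Graph N → List (Subset N)
ocdSets {N} G = filter (isOCD? G) (subsets N)

-- The first argument of min only bounds the result; it is itself attained,
-- because V G is an ocd-set.
γ̃c : ∀ {N} → Graph N → ℕ
γ̃c G = min (order G) (map ∣_∣ (ocdSets G))

d̃ : ∀ {N} → Graph N → ℕ → ℕ
d̃ G i = length (filter (λ S → ∣ S ∣ ≟ⁿ i) (ocdSets G))

-- The summation index runs over γ̃c G, γ̃c G + 1, …, order G.
D̃ : ∀ {N} → Graph N → Poly
D̃ G = ∑ (applyUpTo (λ j → let i = γ̃c G ℕ.+ j in (+ d̃ G i) X^ i) (suc (order G) ∸ γ̃c G))

{-# OPTIONS --safe #-}
module Submission where

-- Encode an ocd-set S of a graph H by its complement C = V H ─ S: then C is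
-- connected (possibly empty) and each of its vertices has a neighbour outside
-- C.  A nonempty C has these properties in G exactly when it has them in some
-- component, which is then unique, while C = ∅ has them in G and in all m
-- components, which accounts for the correction (m − 1) xⁿ.  The factor x^bᵢ
-- turns ∣ C ∣ + k = ∣ V Gᵢ ∣ into ∣ C ∣ + k = n, so in the coefficient of xᵏ
-- all graphs count complements C of the same size n − k.

open import Defs
import Algebra.Properties.Semiring.Sum
open import Data.Bool.Base using (true; false; if_then_else_; _xor_)
open import Data.Fin.Base using (Fin; zero; suc)
open import Data.Fin.Properties using (any?; all?)
open import Data.Fin.Subset using (Subset; inside; outside; _∈_; _∉_; _⊆_; _─_; _-_; ∣_∣; Nonempty)
open import Data.Fin.Subset.Properties
  using ( _∈?_; _⊆?_; nonempty?; drop-∷-⊆; ⊆-antisym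
        ; x∈p∧x∉q⇒x∈p─q; p─q⊆p; p⊆q⇒∣p∣≤∣q∣; x∈p⇒∣p-x∣<∣p∣; Empty-unique; ∣⊥∣≡0 )
open import Data.Integer.Base as ℤ using (ℤ; +_; 0ℤ; 1ℤ)
import Data.Integer.Properties as ℤₚ
open import Data.Integer.Tactic.RingSolver using (solve-∀)
open import Data.List.Base using (List; []; _∷_; _++_; map; filter; length; applyUpTo; tabulate)
open import Data.List.Extrema.Nat using (min≤⊤; min≤xs)
open import Data.List.Properties using (filter-++; length-++; filter-none)
import Data.List.Relation.Unary.All as All
import Data.List.Relation.Unary.All.Properties as All
open import Data.Nat.Base as ℕ using (ℕ; zero; suc; _∸_; _<_; _≥_; s≤s; z≤n)
import Data.Nat.Properties as ℕₚ
open import Data.Product.Base using (∃-syntax; _×_; _,_; proj₁; proj₂)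
open import Data.Sum.Base using (inj₁; inj₂)
import Data.Vec.Base as Vec
open import Data.Vec.Properties using (lookup∘tabulate; []=⇒lookup; lookup⇒[]=)
open import Function.Base using (_∘_)
open import Level using (0ℓ)
open import Relation.Binary.Construct.Closure.ReflexiveTransitive as Star using (Star; ε; _◅_; _◅◅_)
open import Relation.Binary.Core using (Rel)
open import Relation.Binary.PropositionalEquality
  using (_≡_; _≢_; refl; sym; trans; cong; cong₂; subst; module ≡-Reasoning)
open import Relation.Nullary using (Dec; yes; no; does; ¬_; contradiction)
open import Relation.Nullary.Decidable using (_×-dec_; _→-dec_; ¬?; dec-true)
open import Relation.Unary using (Pred; Decidable)

open module ℤSum = Algebra.Properties.Semiring.Sum ℤₚ.+-*-semiring
  using (sum; sum-cong-≗; ∑-distrib-+; *-distribʳ-sum)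

-- Indicators and sums over all subsets

-- The Iverson bracket, with values in the integers so that the correction term can be subtracted.
⟦_⟧ : ∀ {P : Set} → Dec P → ℤ
⟦ P? ⟧ = if does P? then 1ℤ else 0ℤ

⟦⟧-true : ∀ {P : Set} (P? : Dec P) → P → ⟦ P? ⟧ ≡ 1ℤ
⟦⟧-true (yes _) p = refl
⟦⟧-true (no ¬p) p = contradiction p ¬p

⟦⟧-false : ∀ {P : Set} (P? : Dec P) → ¬ P → ⟦ P? ⟧ ≡ 0ℤ
⟦⟧-false (yes p) ¬p = contradiction p ¬p
⟦⟧-false (no _)  ¬p = refl

⟦⟧-cong : ∀ {P Q : Set} (P? : Dec P) (Q? : Dec Q) → (P → Q) → (Q → P) → ⟦ P? ⟧ ≡ ⟦ Q? ⟧
⟦⟧-cong (yes p) Q? f g = sym (⟦⟧-true Q? (f p))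
⟦⟧-cong (no ¬p) Q? f g = sym (⟦⟧-false Q? (¬p ∘ g))

⟦⟧-× : ∀ {P Q : Set} (P? : Dec P) (Q? : Dec Q) → ⟦ P? ×-dec Q? ⟧ ≡ ⟦ P? ⟧ ℤ.* ⟦ Q? ⟧
⟦⟧-× (yes _) Q? = sym (ℤₚ.*-identityˡ ⟦ Q? ⟧)
⟦⟧-× (no _)  Q? = refl

sum-const-1 : ∀ m → sum {m} (λ _ → 1ℤ) ≡ + m
sum-const-1 zero    = refl
sum-const-1 (suc m) = cong (ℤ._+_ 1ℤ) (sum-const-1 m)

sum-zero : ∀ {m} (f : Fin m → ℤ) → (∀ i → f i ≡ 0ℤ) → sum f ≡ 0ℤ
sum-zero {m} f f≗0 = trans (sum-cong-≗ f≗0) (ℤSum.sum-replicate-zero m)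

sum-δ : ∀ {m} (f : Fin m → ℤ) i → f i ≡ 1ℤ → (∀ j → j ≢ i → f j ≡ 0ℤ) → sum f ≡ 1ℤ
sum-δ f zero    fi≡1 f≡0 = cong₂ ℤ._+_ fi≡1 (sum-zero (f ∘ suc) (λ j → f≡0 (suc j) λ ()))
sum-δ f (suc i) fi≡1 f≡0 = cong₂ ℤ._+_ (f≡0 zero λ ())
  (sum-δ (f ∘ suc) i fi≡1 (λ j j≢i → f≡0 (suc j) λ { refl → j≢i refl }))

-- The recursion splits in the same way as `subsets`, so that lengths of filtered lists turn into
-- sums by induction on `N`.
∑ˢ : ∀ {N} → (Subset N → ℤ) → ℤ
∑ˢ {zero}  f = f Vec.[]
∑ˢ {suc N} f = ∑ˢ (λ C → f (outside Vec.∷ C)) ℤ.+ ∑ˢ (λ C → f (inside Vec.∷ C))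

∑ˢ-cong : ∀ {N} {f g : Subset N → ℤ} → (∀ C → f C ≡ g C) → ∑ˢ f ≡ ∑ˢ g
∑ˢ-cong {zero}  f≗g = f≗g Vec.[]
∑ˢ-cong {suc N} f≗g = cong₂ ℤ._+_ 
  (∑ˢ-cong (λ C → f≗g (outside Vec.∷ C)))
  (∑ˢ-cong (λ C → f≗g (inside Vec.∷ C)))

∑ˢ-zero : ∀ N → ∑ˢ {N} (λ _ → 0ℤ) ≡ 0ℤ
∑ˢ-zero zero    = refl
∑ˢ-zero (suc N) = cong₂ ℤ._+_ (∑ˢ-zero N) (∑ˢ-zero N)

∑ˢ-+ : ∀ {N} (f g : Subset N → ℤ) → ∑ˢ (λ C → f C ℤ.+ g C) ≡ ∑ˢ f ℤ.+ ∑ˢ g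
∑ˢ-+ {zero}  f g = refl
∑ˢ-+ {suc N} f g = trans (cong₂ ℤ._+_ (∑ˢ-+ fₒ gₒ) (∑ˢ-+ fᵢ gᵢ))
  (interchange (∑ˢ fₒ) (∑ˢ gₒ) (∑ˢ fᵢ) (∑ˢ gᵢ))
  where
  fₒ fᵢ gₒ gᵢ : Subset N → ℤ
  fₒ C = f (outside Vec.∷ C)
  fᵢ C = f (inside Vec.∷ C)
  gₒ C = g (outside Vec.∷ C)
  gᵢ C = g (inside Vec.∷ C)
  interchange : ∀ a b c d → (a ℤ.+ b) ℤ.+ (c ℤ.+ d) ≡ (a ℤ.+ c) ℤ.+ (b ℤ.+ d)
  interchange = solve-∀

∑ˢ-*ˡ : ∀ {N} a (f : Subset N → ℤ) → ∑ˢ (λ C → a ℤ.* f C) ≡ a ℤ.* ∑ˢ f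
∑ˢ-*ˡ {zero}  a f = refl
∑ˢ-*ˡ {suc N} a f = trans (cong₂ ℤ._+_ (∑ˢ-*ˡ a fₒ) (∑ˢ-*ˡ a fᵢ)) (sym (ℤₚ.*-distribˡ-+ a (∑ˢ fₒ) (∑ˢ fᵢ)))
  where
  fₒ fᵢ : Subset N → ℤ
  fₒ C = f (outside Vec.∷ C)
  fᵢ C = f (inside Vec.∷ C)

∑ˢ-sum : ∀ {N m} (f : Fin m → Subset N → ℤ) → ∑ˢ (λ C → sum (λ i → f i C)) ≡ sum (λ i → ∑ˢ (f i))
∑ˢ-sum {zero}  f = refl
∑ˢ-sum {suc N} {m} f = trans (cong₂ ℤ._+_ (∑ˢ-sum fₒ) (∑ˢ-sum fᵢ))
  (sym (∑-distrib-+ {m} (λ i → ∑ˢ (fₒ i)) (λ i → ∑ˢ (fᵢ i))))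
  where
  fₒ fᵢ : Fin m → Subset N → ℤ
  fₒ i C = f i (outside Vec.∷ C)
  fᵢ i C = f i (inside Vec.∷ C)

-- Only the empty set contributes: in the `inside` half every size is a successor, so every bracket
-- there computes to 0.
∑ˢ-∣∣≡0 : ∀ N → ∑ˢ {N} (λ C → ⟦ ∣ C ∣ ℕₚ.≟ 0 ⟧) ≡ 1ℤ
∑ˢ-∣∣≡0 zero    = refl
∑ˢ-∣∣≡0 (suc N) = cong₂ ℤ._+_ (∑ˢ-∣∣≡0 N) (∑ˢ-zero N)

-- Symmetric differences and relative complements.

infixl 6 _△_

_△_ : ∀ {N} → Subset N → Subset N → Subset N
_△_ = Vec.zipWith _xor_

-- At each coordinate an `outside` entry of p keeps the two halves of the sum in place and an
-- `inside` entry exchanges them.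
∑ˢ-△ : ∀ {N} (p : Subset N) (f : Subset N → ℤ) → ∑ˢ (λ q → f (p △ q)) ≡ ∑ˢ f
∑ˢ-△ Vec.[]              f = refl
∑ˢ-△ (outside Vec.∷ p) f =
  cong₂ ℤ._+_ (∑ˢ-△ p (λ q → f (outside Vec.∷ q))) (∑ˢ-△ p (λ q → f (inside Vec.∷ q)))
∑ˢ-△ (inside  Vec.∷ p) f = trans
  (cong₂ ℤ._+_ (∑ˢ-△ p (λ q → f (inside Vec.∷ q))) (∑ˢ-△ p (λ q → f (outside Vec.∷ q))))
  (ℤₚ.+-comm (∑ˢ (λ q → f (inside Vec.∷ q))) _)

-- A point of q outside p would survive in `p △ q`. This recovers S ⊆ V H when only `V H △ S` is
-- known to lie in V H.
p△q⊆p⇒q⊆p : ∀ {N} (p q : Subset N) → p △ q ⊆ p → q ⊆ p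
p△q⊆p⇒q⊆p (inside  Vec.∷ p) (_      Vec.∷ q) s Vec.here        = Vec.here
p△q⊆p⇒q⊆p (outside Vec.∷ p) (inside Vec.∷ q) s Vec.here        = contradiction (s Vec.here) λ ()
p△q⊆p⇒q⊆p (_       Vec.∷ p) (_      Vec.∷ q) s (Vec.there x∈q) = Vec.there (p△q⊆p⇒q⊆p p q (drop-∷-⊆ s) x∈q)

p△q≡p─q : ∀ {N} (p q : Subset N) → q ⊆ p → p △ q ≡ p ─ q
p△q≡p─q Vec.[]              Vec.[]              s = refl
p△q≡p─q (outside Vec.∷ p) (outside Vec.∷ q) s = cong (outside Vec.∷_) (p△q≡p─q p q (drop-∷-⊆ s))
p△q≡p─q (inside  Vec.∷ p) (outside Vec.∷ q) s = cong (inside  Vec.∷_) (p△q≡p─q p q (drop-∷-⊆ s))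
p△q≡p─q (inside  Vec.∷ p) (inside  Vec.∷ q) s = cong (outside Vec.∷_) (p△q≡p─q p q (drop-∷-⊆ s))
p△q≡p─q (outside Vec.∷ p) (inside  Vec.∷ q) s = contradiction (s Vec.here) λ ()

∣p─q∣+∣q∣≡∣p∣ : ∀ {N} (p q : Subset N) → q ⊆ p → ∣ p ─ q ∣ ℕ.+ ∣ q ∣ ≡ ∣ p ∣
∣p─q∣+∣q∣≡∣p∣ Vec.[]              Vec.[]              s = refl
∣p─q∣+∣q∣≡∣p∣ (outside Vec.∷ p) (outside Vec.∷ q) s = ∣p─q∣+∣q∣≡∣p∣ p q (drop-∷-⊆ s)
∣p─q∣+∣q∣≡∣p∣ (inside  Vec.∷ p) (outside Vec.∷ q) s = cong suc (∣p─q∣+∣q∣≡∣p∣ p q (drop-∷-⊆ s))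
∣p─q∣+∣q∣≡∣p∣ (inside  Vec.∷ p) (inside  Vec.∷ q) s =
  trans (ℕₚ.+-suc ∣ p ─ q ∣ ∣ q ∣) (cong suc (∣p─q∣+∣q∣≡∣p∣ p q (drop-∷-⊆ s)))
∣p─q∣+∣q∣≡∣p∣ (outside Vec.∷ p) (inside  Vec.∷ q) s = contradiction (s Vec.here) λ ()

x∈p─q⇒x∉q : ∀ {N} (p q : Subset N) {x} → x ∈ p ─ q → x ∉ q
x∈p─q⇒x∉q (_ Vec.∷ p) (_ Vec.∷ q) (Vec.there x∈p─q) (Vec.there x∈q) = x∈p─q⇒x∉q p q x∈p─q x∈q

fromDec : ∀ {N} {P : Pred (Fin N) 0ℓ} → Decidable P → Subset N
fromDec P? = Vec.tabulate (λ x → does (P? x))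

∈-fromDec⁺ : ∀ {N} {P : Pred (Fin N) 0ℓ} (P? : Decidable P) {x} → P x → x ∈ fromDec P?
∈-fromDec⁺ P? {x} Px = lookup⇒[]= x _ (trans (lookup∘tabulate _ x) (dec-true (P? x) Px))

∈-fromDec⁻ : ∀ {N} {P : Pred (Fin N) 0ℓ} (P? : Decidable P) {x} → x ∈ fromDec P? → P x
∈-fromDec⁻ P? {x} x∈ with P? x | trans (sym (lookup∘tabulate (λ x → does (P? x)) x)) ([]=⇒lookup x∈)
... | yes Px | _  = Px

-- Coefficients

coeff-+ₚ : ∀ p q k → coeff (p +ₚ q) k ≡ coeff p k ℤ.+ coeff q k
coeff-+ₚ []      q       k       = sym (ℤₚ.+-identityˡ _)
coeff-+ₚ (a ∷ p) []      k       = sym (ℤₚ.+-identityʳ _)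
coeff-+ₚ (a ∷ p) (b ∷ q) zero    = refl
coeff-+ₚ (a ∷ p) (b ∷ q) (suc k) = coeff-+ₚ p q k

coeff-map : ∀ (f : ℤ → ℤ) → f 0ℤ ≡ 0ℤ → ∀ p k → coeff (map f p) k ≡ f (coeff p k)
coeff-map f f0≡0 []      k       = sym f0≡0
coeff-map f f0≡0 (a ∷ p) zero    = refl
coeff-map f f0≡0 (a ∷ p) (suc k) = coeff-map f f0≡0 p k

coeff--ₚ : ∀ p q k → coeff (p -ₚ q) k ≡ coeff p k ℤ.- coeff q k
coeff--ₚ p q k = trans (coeff-+ₚ p _ k) (cong (ℤ._+_ (coeff p k)) (coeff-map ℤ.-_ refl q k))

coeff-X^ : ∀ c i k → coeff (c X^ i) k ≡ c ℤ.* ⟦ i ℕₚ.≟ k ⟧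
coeff-X^ c zero    zero    = sym (ℤₚ.*-identityʳ c)
coeff-X^ c zero    (suc k) = sym (ℤₚ.*-zeroʳ c)
coeff-X^ c (suc i) zero    = sym (ℤₚ.*-zeroʳ c)
coeff-X^ c (suc i) (suc k) = trans (coeff-X^ c i k)
  (cong (c ℤ.*_) (⟦⟧-cong (i ℕₚ.≟ k) (suc i ℕₚ.≟ suc k) (cong suc) ℕₚ.suc-injective))

coeff-X^-≢ : ∀ c {i k} → i ≢ k → coeff (c X^ i) k ≡ 0ℤ
coeff-X^-≢ c {i} {k} i≢k =
  trans (coeff-X^ c i k) (trans (cong (c ℤ.*_) (⟦⟧-false (i ℕₚ.≟ k) i≢k)) (ℤₚ.*-zeroʳ c))

coeff-∑-tabulate : ∀ {m} (f : Fin m → Poly) k → coeff (∑ (tabulate f)) k ≡ sum (λ i → coeff (f i) k)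
coeff-∑-tabulate {zero}  f k = refl
coeff-∑-tabulate {suc m} f k =
  trans (coeff-+ₚ (f zero) _ k) (cong (ℤ._+_ (coeff (f zero) k)) (coeff-∑-tabulate (f ∘ suc) k))

coeff-X^0-*ₚ : ∀ p k → coeff (1ℤ X^ 0 *ₚ p) k ≡ coeff p k
coeff-X^0-*ₚ p k = begin
  coeff (map (1ℤ ℤ.*_) p +ₚ (0ℤ ∷ [])) k                ≡⟨ coeff-+ₚ (map (1ℤ ℤ.*_) p) _ k ⟩
  coeff (map (1ℤ ℤ.*_) p) k ℤ.+ coeff (0ℤ ∷ []) k       ≡⟨ cong₂ ℤ._+_ (coeff-map (1ℤ ℤ.*_) refl p k) (coeff-0 k) ⟩
  1ℤ ℤ.* coeff p k ℤ.+ 0ℤ                               ≡⟨ simplify (coeff p k) ⟩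
  coeff p k                                             ∎
  where
  open ≡-Reasoning
  coeff-0 : ∀ k → coeff (0ℤ ∷ []) k ≡ 0ℤ
  coeff-0 zero    = refl
  coeff-0 (suc k) = refl
  simplify : ∀ a → 1ℤ ℤ.* a ℤ.+ 0ℤ ≡ a
  simplify = solve-∀

-- The zero constant term contributes only zeros, so one factor x can be peeled off a monomial at a
-- time.
coeff-0∷-*ₚ : ∀ p q k → coeff ((0ℤ ∷ p) *ₚ q) k ≡ coeff (0ℤ ∷ p *ₚ q) k
coeff-0∷-*ₚ p q k = trans (coeff-+ₚ (map (0ℤ ℤ.*_) q) _ k)
  (trans (cong (ℤ._+ coeff (0ℤ ∷ p *ₚ q) k) (coeff-map (0ℤ ℤ.*_) refl q k)) (ℤₚ.+-identityˡ _))

module _ (c : ℕ → ℤ) (k : ℕ) where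

  -- The exponents are an arbitrary function `h` because the induction along `applyUpTo` replaces
  -- `h` by `h ∘ suc`.
  coeff-∑-∉ : ∀ (h : ℕ → ℕ) n → (∀ {j} → j < n → h j ≢ k) →
              coeff (∑ (applyUpTo (λ j → c (h j) X^ h j) n)) k ≡ 0ℤ
  coeff-∑-∉ h zero    k∉h = refl
  coeff-∑-∉ h (suc n) k∉h = trans (coeff-+ₚ (c (h 0) X^ h 0) _ k)
    (cong₂ ℤ._+_ (coeff-X^-≢ (c (h 0)) (k∉h (s≤s z≤n))) (coeff-∑-∉ (h ∘ suc) n (λ j<n → k∉h (s≤s j<n))))

  -- Injectivity of `h` leaves exactly one term with exponent k; all other terms vanish there.
  coeff-∑-∈ : ∀ (h : ℕ → ℕ) → (∀ {i j} → h i ≡ h j → i ≡ j) → ∀ {n j} → j < n → h j ≡ k →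
              coeff (∑ (applyUpTo (λ j → c (h j) X^ h j) n)) k ≡ c k
  coeff-∑-∈ h inj {suc n} {zero} j<n refl = trans (coeff-+ₚ (c k X^ k) _ k)
    (trans (cong₂ ℤ._+_ head (coeff-∑-∉ (h ∘ suc) n λ _ eq → contradiction (inj eq) λ ()))
           (ℤₚ.+-identityʳ _))
    where
    head : coeff (c k X^ k) k ≡ c k
    head = trans (coeff-X^ (c k) k k) (trans (cong (c k ℤ.*_) (⟦⟧-true (k ℕₚ.≟ k) refl)) (ℤₚ.*-identityʳ _))
  coeff-∑-∈ h inj {suc n} {suc j} (s≤s j<n) refl = trans (coeff-+ₚ (c (h 0) X^ h 0) _ k)
    (trans (cong₂ ℤ._+_ (coeff-X^-≢ (c (h 0)) (λ eq → contradiction (inj eq) λ ()))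
                        (coeff-∑-∈ (h ∘ suc) (ℕₚ.suc-injective ∘ inj) j<n refl))
           (ℤₚ.+-identityˡ _))

-- From filtered lists of subsets to sums of indicators.

filter-map-length : ∀ {A B : Set} {P : Pred B 0ℓ} (P? : Decidable P) (f : A → B) xs →
                    length (filter P? (map f xs)) ≡ length (filter (P? ∘ f) xs)
filter-map-length P? f []       = refl
filter-map-length P? f (x ∷ xs) with does (P? (f x))
... | true  = cong suc (filter-map-length P? f xs)
... | false = filter-map-length P? f xs

filter-filter : ∀ {A : Set} {P Q : Pred A 0ℓ} (P? : Decidable P) (Q? : Decidable Q) xs →
                filter Q? (filter P? xs) ≡ filter (λ x → P? x ×-dec Q? x) xs
filter-filter P? Q? []       = refl
filter-filter P? Q? (x ∷ xs) with does (P? x)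
... | false = filter-filter P? Q? xs
... | true with does (Q? x)
...   | true  = cong (x ∷_) (filter-filter P? Q? xs)
...   | false = filter-filter P? Q? xs

filter-subsets : ∀ {N} {P : Pred (Subset N) 0ℓ} (P? : Decidable P) →
                 + length (filter P? (subsets N)) ≡ ∑ˢ (λ S → ⟦ P? S ⟧)
filter-subsets {zero} P? with does (P? Vec.[])
... | true  = refl
... | false = refl
filter-subsets {suc N} P? = begin
  + length (filter P? (outs ++ ins))                          ≡⟨ cong (+_ ∘ length) (filter-++ P? outs ins) ⟩
  + length (filter P? outs ++ filter P? ins)                  ≡⟨ cong +_ (length-++ (filter P? outs)) ⟩
  + length (filter P? outs) ℤ.+ + length (filter P? ins)      ≡⟨ cong₂ ℤ._+_ (half outside) (half inside) ⟩
  ∑ˢ (λ S → ⟦ P? S ⟧)                                         ∎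
  where
  open ≡-Reasoning
  outs ins : List (Subset (suc N))
  outs = map (outside Vec.∷_) (subsets N)
  ins  = map (inside Vec.∷_) (subsets N)
  half : ∀ b → + length (filter P? (map (b Vec.∷_) (subsets N))) ≡ ∑ˢ (λ S → ⟦ P? (b Vec.∷ S) ⟧)
  half b = trans (cong +_ (filter-map-length P? (b Vec.∷_) (subsets N))) (filter-subsets (λ S → P? (b Vec.∷ S)))

-- Restricting the summation range loses nothing. Below `γ̃c H` there is no ocd-set because `γ̃c H`
-- bounds all their sizes from below, and above `order H` there is none because ocd-sets lie in V H.
coeff-D̃ : ∀ {N} (H : Graph N) k → coeff (D̃ H) k ≡ + d̃ H k
coeff-D̃ H k with γ̃c H ℕₚ.≤? k | k ℕₚ.≤? order H
... | yes γ≤k | yes k≤n = coeff-∑-∈ (λ i → + d̃ H i) k (γ̃c H ℕ.+_) (ℕₚ.+-cancelˡ-≡ (γ̃c H) _ _)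
  (ℕₚ.∸-monoˡ-< (s≤s k≤n) γ≤k) (ℕₚ.m+[n∸m]≡n γ≤k)
... | no γ≰k  | _ = trans
  (coeff-∑-∉ (λ i → + d̃ H i) k (γ̃c H ℕ.+_) (suc (order H) ∸ γ̃c H)
    (λ { {j} _ refl → γ≰k (ℕₚ.m≤m+n _ j) }))
  (cong (+_ ∘ length) (sym (filter-none _ (All.map (λ { γ≤ refl → γ≰k γ≤ })
    (All.map⁻ (min≤xs (order H) (map ∣_∣ (ocdSets H))))))))
... | yes _   | no k≰n = trans
  (coeff-∑-∉ (λ i → + d̃ H i) k (γ̃c H ℕ.+_) (suc (order H) ∸ γ̃c H)
    (λ { {j} j< refl → k≰n (ℕ.s≤s⁻¹
      (subst (k <_) (ℕₚ.m+[n∸m]≡n γ≤1+n) (ℕₚ.+-monoʳ-< (γ̃c H) j<))) }))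
  (cong (+_ ∘ length) (sym (filter-none _
    (All.map (λ { (S⊆V , _) refl → k≰n (p⊆q⇒∣p∣≤∣q∣ S⊆V) }) (All.all-filter (isOCD? H) (subsets _))))))
  -- This makes the truncated subtraction in the length of the range exact, so the largest exponent
  -- is `order H`.
  where γ≤1+n = ℕₚ.m≤n⇒m≤1+n (min≤⊤ (order H) (map ∣_∣ (ocdSets H)))

-- Complements of ocd-sets

-- By definition the adjacency of the subgraph induced by C, but available without a proof that C is
-- nonempty.
Within : ∀ {N} → Graph N → Subset N → Rel (Fin N) 0ℓ
Within H C u v = u ∈ C × v ∈ C × Graph._~_ H u v

-- Both alternatives of `OuterConnected` are merged: for C = ∅, that is S = V H, the connectivity
-- clause holds vacuously.
Outer : ∀ {N} → Graph N → Subset N → Set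
Outer H C = C ⊆ V H
          × (∀ v → v ∈ C → ∃[ u ] u ∉ C × Graph._~_ H v u)
          × (∀ u v → u ∈ C → v ∈ C → Star (Within H C) u v)

outer? : ∀ {N} (H : Graph N) → Decidable (Outer H)
outer? H C = C ⊆? V H
  ×-dec (all? λ v → v ∈? C →-dec any? λ u → ¬? (u ∈? C) ×-dec v ~? u)
  ×-dec (all? λ u → all? λ v → u ∈? C →-dec v ∈? C →-dec
           star? (λ x y → x ∈? C ×-dec y ∈? C ×-dec x ~? y) u v)
  where open Graph H using (_~?_)

IsOCD⇒Outer : ∀ {N} (H : Graph N) (S : Subset N) → IsOCD H S → Outer H (V H ─ S)
IsOCD⇒Outer H S (S⊆V , dom , oc) = p─q⊆p (V H) S , boundary , connected oc
  where
  boundary : ∀ v → v ∈ V H ─ S → ∃[ u ] u ∉ V H ─ S × Graph._~_ H v u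
  boundary v v∈ with u , u∈S , v~u ← dom v (p─q⊆p (V H) S v∈) (x∈p─q⇒x∉q (V H) S v∈) =
    u , (λ u∈ → x∈p─q⇒x∉q (V H) S u∈ u∈S) , v~u
  connected : OuterConnected H S → ∀ u v → u ∈ V H ─ S → v ∈ V H ─ S → Star (Within H (V H ─ S)) u v
  connected (inj₁ refl)    u v u∈ v∈ = contradiction (p─q⊆p (V H) S u∈) (x∈p─q⇒x∉q (V H) S u∈)
  connected (inj₂ (_ , c)) u v u∈ v∈ = c u v u∈ v∈

-- A neighbour outside the complement is still a vertex of H, since edges have both ends in V H;
-- hence it lies in S and dominates. Whether the complement is empty selects the alternative of
-- `OuterConnected`.
Outer⇒IsOCD : ∀ {N} (H : Graph N) (S : Subset N) → S ⊆ V H → Outer H (V H ─ S) → IsOCD H S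
Outer⇒IsOCD H S S⊆V (_ , boundary , connected) = S⊆V , dominating , outerConnected
  where
  open Graph H using (~-sym; ~⇒∈)
  V─S-∌⇒∈ : ∀ {x} → x ∈ V H → x ∉ V H ─ S → x ∈ S
  V─S-∌⇒∈ {x} x∈V x∉ with x ∈? S
  ... | yes x∈S = x∈S
  ... | no  x∉S = contradiction (x∈p∧x∉q⇒x∈p─q x∈V x∉S) x∉
  dominating : Dominating H S
  dominating v v∈V v∉S with u , u∉ , v~u ← boundary v (x∈p∧x∉q⇒x∈p─q v∈V v∉S) =
    u , V─S-∌⇒∈ (~⇒∈ (~-sym v~u)) u∉ , v~u
  outerConnected : OuterConnected H S
  outerConnected with nonempty? (V H ─ S)
  ... | yes ne = inj₂ (ne , connected)
  ... | no ¬ne = inj₁ (⊆-antisym S⊆V (λ x∈V → V─S-∌⇒∈ x∈V (λ x∈ → ¬ne (_ , x∈))))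

-- Counts complements of size n - k, stated additively to avoid truncated subtraction. The total n
-- is a parameter, so that a component can be measured against the order of the whole graph.
outerCount : ∀ {N} → Graph N → ℕ → ℕ → ℤ
outerCount H n k = ∑ˢ (λ C → ⟦ outer? H C ×-dec (∣ C ∣ ℕ.+ k ℕₚ.≟ n) ⟧)

-- For S ⊆ V H the complement V H ─ S is V H △ S, and V H △_ permutes all subsets.
d̃≡outerCount : ∀ {N} (H : Graph N) k → + d̃ H k ≡ outerCount H (order H) k
d̃≡outerCount {N} H k = begin
  + d̃ H k
    ≡⟨ cong (+_ ∘ length) (filter-filter (isOCD? H) (λ S → ∣ S ∣ ℕₚ.≟ k) (subsets N)) ⟩
  + length (filter (λ S → isOCD? H S ×-dec (∣ S ∣ ℕₚ.≟ k)) (subsets N))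
    ≡⟨ filter-subsets (λ S → isOCD? H S ×-dec (∣ S ∣ ℕₚ.≟ k)) ⟩
  ∑ˢ (λ S → ⟦ isOCD? H S ×-dec (∣ S ∣ ℕₚ.≟ k) ⟧)
    ≡⟨ ∑ˢ-cong (λ S → ⟦⟧-cong (isOCD? H S ×-dec (∣ S ∣ ℕₚ.≟ k)) (P? (V H △ S)) (to S) (from S)) ⟩
  ∑ˢ (λ S → ⟦ P? (V H △ S) ⟧)
    ≡⟨ ∑ˢ-△ (V H) (λ C → ⟦ P? C ⟧) ⟩
  outerCount H (order H) k ∎
  where
  open ≡-Reasoning
  P : Subset N → Set
  P C = Outer H C × ∣ C ∣ ℕ.+ k ≡ order H
  P? : Decidable P
  P? C = outer? H C ×-dec (∣ C ∣ ℕ.+ k ℕₚ.≟ order H)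
  to : ∀ S → IsOCD H S × ∣ S ∣ ≡ k → P (V H △ S)
  to S (ocd , refl) = subst P (sym (p△q≡p─q (V H) S (proj₁ ocd)))
    (IsOCD⇒Outer H S ocd , ∣p─q∣+∣q∣≡∣p∣ (V H) S (proj₁ ocd))
  from : ∀ S → P (V H △ S) → IsOCD H S × ∣ S ∣ ≡ k
  from S P△ =
    Outer⇒IsOCD H S S⊆V outer , ℕₚ.+-cancelˡ-≡ ∣ V H ─ S ∣ _ _ (trans (∣p─q∣+∣q∣≡∣p∣ (V H) S S⊆V) (sym size))
    where
    S⊆V : S ⊆ V H
    S⊆V = p△q⊆p⇒q⊆p (V H) S (proj₁ (proj₁ P△))
    P─ = subst P (p△q≡p─q (V H) S S⊆V) P△
    outer = proj₁ P─
    size = proj₂ P─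

-- Induction on b: each factor x raises both k and the total by one, which preserves
-- `∣ C ∣ + k = n`. If k reaches 0 while b is positive, C would need more than `order H` vertices,
-- so both sides are 0.
coeff-X^-*ₚ-D̃ : ∀ {N} (H : Graph N) b k → coeff (1ℤ X^ b *ₚ D̃ H) k ≡ outerCount H (b ℕ.+ order H) k
coeff-X^-*ₚ-D̃ H zero k = trans (coeff-X^0-*ₚ (D̃ H) k) (trans (coeff-D̃ H k) (d̃≡outerCount H k))
coeff-X^-*ₚ-D̃ {N} H (suc b) zero = trans (coeff-0∷-*ₚ (1ℤ X^ b) (D̃ H) 0) (sym (begin
  outerCount H (suc b ℕ.+ order H) 0
    ≡⟨ ∑ˢ-cong (λ C → ⟦⟧-false (outer? H C ×-dec (∣ C ∣ ℕ.+ 0 ℕₚ.≟ suc b ℕ.+ order H)) (too-big C)) ⟩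
  ∑ˢ {N} (λ _ → 0ℤ)
    ≡⟨ ∑ˢ-zero N ⟩
  0ℤ ∎))
  where
  open ≡-Reasoning
  too-big : ∀ C → ¬ (Outer H C × ∣ C ∣ ℕ.+ 0 ≡ suc b ℕ.+ order H)
  too-big C ((C⊆V , _) , size) = ℕₚ.<⇒≢ (ℕₚ.<-≤-trans (s≤s (p⊆q⇒∣p∣≤∣q∣ C⊆V)) (s≤s (ℕₚ.m≤n+m (order H) b)))
    (trans (sym (ℕₚ.+-identityʳ ∣ C ∣)) size)
coeff-X^-*ₚ-D̃ H (suc b) (suc k) = trans (coeff-0∷-*ₚ (1ℤ X^ b) (D̃ H) (suc k))
  (trans (coeff-X^-*ₚ-D̃ H b k)
  (∑ˢ-cong λ C → ⟦⟧-cong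
    (outer? H C ×-dec (∣ C ∣ ℕ.+ k ℕₚ.≟ b ℕ.+ order H))
    (outer? H C ×-dec (∣ C ∣ ℕ.+ suc k ℕₚ.≟ suc b ℕ.+ order H))
    (λ { (o , size) → o , trans (ℕₚ.+-suc ∣ C ∣ k) (cong suc size) })
    (λ { (o , size) → o , ℕₚ.suc-injective (trans (sym (ℕₚ.+-suc ∣ C ∣ k)) size) })))

-- Components

module _ {N : ℕ} (G : Graph N) where

  open Graph G using (_~_; _~?_; ~-sym; ~⇒∈)

  reachable : Fin N → Subset N
  reachable x = fromDec (star? _~?_ x)

  Star⇒∈reachable : ∀ {x y} → Star _~_ x y → y ∈ reachable x
  Star⇒∈reachable {x} = ∈-fromDec⁺ (star? _~?_ x)

  ∈reachable⇒Star : ∀ {x y} → y ∈ reachable x → Star _~_ x y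
  ∈reachable⇒Star {x} = ∈-fromDec⁻ (star? _~?_ x)

  Star-∈V : ∀ {x y} → x ∈ V G → Star _~_ x y → y ∈ V G
  Star-∈V x∈V ε            = x∈V
  Star-∈V x∈V (x~z ◅ z⟶y) = Star-∈V (~⇒∈ (~-sym x~z)) z⟶y

  componentOf : ∀ x → x ∈ V G → Graph N
  componentOf x x∈V = induced G (reachable x) (λ y∈ → Star-∈V x∈V (∈reachable⇒Star y∈)) (x , Star⇒∈reachable ε)

  -- The walk from x to the current vertex is extended along the induction; it certifies that each
  -- vertex passed is reachable.
  Star-within-reachable : ∀ {x u v} → Star _~_ x u → Star _~_ u v → Star (Within G (reachable x)) u v
  Star-within-reachable x⟶u ε            = ε
  Star-within-reachable x⟶u (u~w ◅ w⟶v) =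
    (Star⇒∈reachable x⟶u , Star⇒∈reachable x⟶w , u~w) ◅ Star-within-reachable x⟶w w⟶v
    where x⟶w = x⟶u ◅◅ u~w ◅ ε

  componentOf-subgraph : ∀ {x} (x∈V : x ∈ V G) → componentOf x x∈V ≤ᴳ G
  componentOf-subgraph x∈V = (λ y∈ → Star-∈V x∈V (∈reachable⇒Star y∈)) , λ { _ _ (_ , _ , u~v) → u~v }

  -- Go from u back to x and then on to v; this walk starts at a reachable vertex and therefore
  -- never leaves the reachable set.
  componentOf-connected : ∀ {x} (x∈V : x ∈ V G) → Connected (componentOf x x∈V)
  componentOf-connected x∈V u v u∈ v∈ =
    Star-within-reachable x⟶u (Star.reverse ~-sym x⟶u ◅◅ ∈reachable⇒Star v∈)
    where x⟶u = ∈reachable⇒Star u∈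

  connected-≤-componentOf : ∀ {x} (x∈V : x ∈ V G) K → K ≤ᴳ G → Connected K → x ∈ V K → K ≤ᴳ componentOf x x∈V
  connected-≤-componentOf {x} x∈V K (_ , E⊆) conn x∈K = V⊆ , λ u v u~v →
    V⊆ (Graph.~⇒∈ K u~v) , V⊆ (Graph.~⇒∈ K (Graph.~-sym K u~v)) , E⊆ u v u~v
    where
    V⊆ : V K ⊆ reachable x
    V⊆ {y} y∈K = Star⇒∈reachable (Star.map (λ {u} {v} → E⊆ u v) (conn x y x∈K y∈K))

  componentOf-isComponent : ∀ {x} (x∈V : x ∈ V G) → IsComponent G (componentOf x x∈V)
  componentOf-isComponent x∈V = record
    { subgraph  = componentOf-subgraph x∈V
    ; connected = componentOf-connected x∈V
    ; maximal   = λ K K≤G conn (V⊆ , _) → connected-≤-componentOf x∈V K K≤G conn (V⊆ (Star⇒∈reachable ε))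
    }

  module _ {H : Graph N} (H-comp : IsComponent G H) where

    open IsComponent H-comp

    -- H is connected and contains u, so it lies below `componentOf u`; by maximality
    -- `componentOf u` lies below H, and it contains the edge uv. Thus a component is induced and
    -- closed under adjacency in G.
    component-~ : ∀ {u v} → u ∈ V H → u ~ v → Graph._~_ H u v
    component-~ {u} {v} u∈H u~v = proj₂
      (maximal (componentOf u u∈V) (componentOf-subgraph u∈V) (componentOf-connected u∈V)
        (connected-≤-componentOf u∈V H subgraph connected u∈H))
      u v (Star⇒∈reachable ε , Star⇒∈reachable (u~v ◅ ε) , u~v)
      where u∈V = proj₁ subgraph u∈H

    component-Star : ∀ {u v} → u ∈ V H → Star _~_ u v → v ∈ V H
    component-Star u∈H ε            = u∈H
    component-Star u∈H (u~w ◅ w⟶v) = component-Star (Graph.~⇒∈ H (Graph.~-sym H (component-~ u∈H u~w))) w⟶v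

    Outer-component⇒Outer : ∀ {C} → Outer H C → Outer G C
    Outer-component⇒Outer (C⊆H , boundary , conn) =
        (λ x∈C → proj₁ subgraph (C⊆H x∈C))
      , (λ v v∈C → let u , u∉C , v~u = boundary v v∈C in u , u∉C , proj₂ subgraph v u v~u)
      , (λ u v u∈C v∈C → Star.map (λ { (x∈ , y∈ , x~y) → x∈ , y∈ , proj₂ subgraph _ _ x~y }) (conn u v u∈C v∈C))

    -- One common vertex suffices: C is connected in G, so closure of H under walks puts all of C
    -- inside H, and every edge of G at a vertex of C is then an edge of H.
    Outer⇒Outer-component : ∀ {C x} → x ∈ C → x ∈ V H → Outer G C → Outer H C
    Outer⇒Outer-component {C} {x} x∈C x∈H (_ , boundary , conn) =
        C⊆H
      , (λ v v∈C → let u , u∉C , v~u = boundary v v∈C in u , u∉C , component-~ (C⊆H v∈C) v~u)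
      , (λ u v u∈C v∈C → Star.map (λ { (x∈ , y∈ , x~y) → x∈ , y∈ , component-~ (C⊆H x∈) x~y }) (conn u v u∈C v∈C))
      where
      C⊆H : C ⊆ V H
      C⊆H {y} y∈C = component-Star x∈H (Star.map (λ { (_ , _ , x~y) → x~y }) (conn x y x∈C y∈C))

  -- Walks of H starting at x are walks of G, and K is closed under those. Used in both directions,
  -- this shows that components sharing a vertex are identified by `_≈ᴳ_`.
  component-≤ : ∀ {H K x} → IsComponent G H → IsComponent G K → x ∈ V H → x ∈ V K → H ≤ᴳ K
  component-≤ {H} {K} {x} H-comp K-comp x∈H x∈K = V⊆ , λ u v u~v →
    component-~ K-comp (V⊆ (Graph.~⇒∈ H u~v)) (E⊆ u v u~v)
    where
    E⊆ = proj₂ (IsComponent.subgraph H-comp)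
    V⊆ : V H ⊆ V K
    V⊆ {y} y∈H = component-Star K-comp x∈K
      (Star.map (λ {u} {v} → E⊆ u v) (IsComponent.connected H-comp x y x∈H y∈H))

-- Summing over the components.

Nonempty⇒∣∣≢0 : ∀ {N} {C : Subset N} → Nonempty C → ∣ C ∣ ≢ 0
Nonempty⇒∣∣≢0 {C = C} (x , x∈C) size = ℕₚ.n≮0 (subst (∣ C - x ∣ <_) size (x∈p⇒∣p-x∣<∣p∣ x∈C))

¬Nonempty⇒∣∣≡0 : ∀ {N} {C : Subset N} → ¬ Nonempty C → ∣ C ∣ ≡ 0
¬Nonempty⇒∣∣≡0 {N} ¬ne = trans (cong ∣_∣ (Empty-unique ¬ne)) (∣⊥∣≡0 N)

¬Nonempty⇒Outer : ∀ {N} (H : Graph N) {C} → ¬ Nonempty C → Outer H C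
¬Nonempty⇒Outer H ¬ne = (λ x∈C → contradiction (_ , x∈C) ¬ne)
                      , (λ v v∈C → contradiction (_ , v∈C) ¬ne)
                      , (λ u v u∈C → contradiction (_ , u∈C) ¬ne)

module _ {N m : ℕ} (G : Graph N) (Gᵢ : Fin m → Graph N) (comps : AreComponents G Gᵢ) where

  open AreComponents comps

  sum-outer : ∀ C → sum (λ i → ⟦ outer? (Gᵢ i) C ⟧) ≡ ⟦ outer? G C ⟧ ℤ.+ (+ m ℤ.- 1ℤ) ℤ.* ⟦ ∣ C ∣ ℕₚ.≟ 0 ⟧
  sum-outer C with nonempty? C
  ... | no ¬ne = begin
    sum (λ i → ⟦ outer? (Gᵢ i) C ⟧)
      ≡⟨ sum-cong-≗ (λ i → ⟦⟧-true (outer? (Gᵢ i) C) (¬Nonempty⇒Outer (Gᵢ i) ¬ne)) ⟩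
    sum {m} (λ _ → 1ℤ)
      ≡⟨ sum-const-1 m ⟩
    + m
      ≡⟨ split (+ m) ⟩
    1ℤ ℤ.+ (+ m ℤ.- 1ℤ) ℤ.* 1ℤ
      ≡⟨ cong₂ (λ a b → a ℤ.+ (+ m ℤ.- 1ℤ) ℤ.* b) (⟦⟧-true (outer? G C) (¬Nonempty⇒Outer G ¬ne))
                                              (⟦⟧-true (∣ C ∣ ℕₚ.≟ 0) (¬Nonempty⇒∣∣≡0 ¬ne)) ⟨
    ⟦ outer? G C ⟧ ℤ.+ (+ m ℤ.- 1ℤ) ℤ.* ⟦ ∣ C ∣ ℕₚ.≟ 0 ⟧ ∎
    where
    open ≡-Reasoning
    split : ∀ a → a ≡ 1ℤ ℤ.+ (a ℤ.- 1ℤ) ℤ.* 1ℤ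
    split = solve-∀
  ... | yes ne@(x , x∈C) = begin
    sum (λ i → ⟦ outer? (Gᵢ i) C ⟧)
      ≡⟨ unique (outer? G C) ⟩
    ⟦ outer? G C ⟧
      ≡⟨ pad ⟦ outer? G C ⟧ (+ m ℤ.- 1ℤ) ⟩
    ⟦ outer? G C ⟧ ℤ.+ (+ m ℤ.- 1ℤ) ℤ.* 0ℤ
      ≡⟨ cong (λ b → ⟦ outer? G C ⟧ ℤ.+ (+ m ℤ.- 1ℤ) ℤ.* b) (⟦⟧-false (∣ C ∣ ℕₚ.≟ 0) (Nonempty⇒∣∣≢0 ne)) ⟨
    ⟦ outer? G C ⟧ ℤ.+ (+ m ℤ.- 1ℤ) ℤ.* ⟦ ∣ C ∣ ℕₚ.≟ 0 ⟧ ∎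
    where
    open ≡-Reasoning
    pad : ∀ a b → a ≡ a ℤ.+ b ℤ.* 0ℤ
    pad = solve-∀
    -- The decision is taken as an argument so that splitting on it evaluates the bracket on the
    -- right.
    unique : (d : Dec (Outer G C)) → sum (λ i → ⟦ outer? (Gᵢ i) C ⟧) ≡ ⟦ d ⟧
    unique (no ¬outer) = sum-zero _ λ i →
      ⟦⟧-false (outer? (Gᵢ i) C) (¬outer ∘ Outer-component⇒Outer G (component i))
    -- The index i is that of the component containing the chosen vertex x of C.
    unique (yes outer) with x∈V ← proj₁ outer x∈C
      with i , ((V⊆ , _) , _) ← complete _ (componentOf-isComponent G x∈V) =
      let x∈Gᵢ = V⊆ (Star⇒∈reachable G ε) in
      sum-δ _ i (⟦⟧-true (outer? (Gᵢ i) C) (Outer⇒Outer-component G (component i) x∈C x∈Gᵢ outer)) λ j j≢i →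
        -- If C also lay in `Gᵢ j`, that component would share x with `Gᵢ i`, and `distinct` would
        -- force j = i.
        ⟦⟧-false (outer? (Gᵢ j) C) λ { (C⊆Gⱼ , _) → j≢i (distinct
          ( component-≤ G (component j) (component i) (C⊆Gⱼ x∈C) x∈Gᵢ
          , component-≤ G (component i) (component j) x∈Gᵢ (C⊆Gⱼ x∈C))) }

  -- `sum-outer` is weighted by the bracket of `∣ C ∣ + k = n` and summed over all C. The correction
  -- survives only at C = ∅, where the size condition reads n = k.
  sum-outerCount : ∀ k → sum (λ i → outerCount (Gᵢ i) (order G) k) ≡
                   outerCount G (order G) k ℤ.+ (+ m ℤ.- 1ℤ) ℤ.* ⟦ order G ℕₚ.≟ k ⟧
  sum-outerCount k = begin
    sum (λ i → outerCount (Gᵢ i) n k)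
      ≡⟨ ∑ˢ-sum (λ i C → ⟦ outer? (Gᵢ i) C ×-dec size? C ⟧) ⟨
    ∑ˢ (λ C → sum (λ i → ⟦ outer? (Gᵢ i) C ×-dec size? C ⟧))
      ≡⟨ ∑ˢ-cong pointwise ⟩
    ∑ˢ (λ C → ⟦ outer? G C ×-dec size? C ⟧ ℤ.+ (a ℤ.* ⟦ n ℕₚ.≟ k ⟧) ℤ.* ⟦ ∣ C ∣ ℕₚ.≟ 0 ⟧)
      ≡⟨ ∑ˢ-+ {N} (λ C → ⟦ outer? G C ×-dec size? C ⟧) (λ C → (a ℤ.* ⟦ n ℕₚ.≟ k ⟧) ℤ.* ⟦ ∣ C ∣ ℕₚ.≟ 0 ⟧) ⟩
    outerCount G n k ℤ.+ ∑ˢ {N} (λ C → (a ℤ.* ⟦ n ℕₚ.≟ k ⟧) ℤ.* ⟦ ∣ C ∣ ℕₚ.≟ 0 ⟧)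
      ≡⟨ cong (ℤ._+_ (outerCount G n k)) (∑ˢ-*ˡ {N} (a ℤ.* ⟦ n ℕₚ.≟ k ⟧) (λ C → ⟦ ∣ C ∣ ℕₚ.≟ 0 ⟧)) ⟩
    outerCount G n k ℤ.+ (a ℤ.* ⟦ n ℕₚ.≟ k ⟧) ℤ.* ∑ˢ {N} (λ C → ⟦ ∣ C ∣ ℕₚ.≟ 0 ⟧)
      ≡⟨ cong (λ s → outerCount G n k ℤ.+ (a ℤ.* ⟦ n ℕₚ.≟ k ⟧) ℤ.* s) (∑ˢ-∣∣≡0 N) ⟩
    outerCount G n k ℤ.+ (a ℤ.* ⟦ n ℕₚ.≟ k ⟧) ℤ.* 1ℤ
      ≡⟨ cong (ℤ._+_ (outerCount G n k)) (ℤₚ.*-identityʳ _) ⟩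
    outerCount G n k ℤ.+ a ℤ.* ⟦ n ℕₚ.≟ k ⟧ ∎
    where
    open ≡-Reasoning
    n = order G
    a = + m ℤ.- 1ℤ
    size? : ∀ C → Dec (∣ C ∣ ℕ.+ k ≡ n)
    size? C = ∣ C ∣ ℕ.+ k ℕₚ.≟ n
    expand : ∀ o a z d → (o ℤ.+ a ℤ.* z) ℤ.* d ≡ o ℤ.* d ℤ.+ a ℤ.* (z ℤ.* d)
    expand = solve-∀
    -- Once `∣ C ∣ = 0`, the size condition no longer depends on C, so its bracket can be pulled out
    -- of the sum over C.
    swap : ∀ C → ⟦ ∣ C ∣ ℕₚ.≟ 0 ⟧ ℤ.* ⟦ size? C ⟧ ≡ ⟦ n ℕₚ.≟ k ⟧ ℤ.* ⟦ ∣ C ∣ ℕₚ.≟ 0 ⟧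
    swap C = begin
      ⟦ ∣ C ∣ ℕₚ.≟ 0 ⟧ ℤ.* ⟦ size? C ⟧
        ≡⟨ ⟦⟧-× (∣ C ∣ ℕₚ.≟ 0) (size? C) ⟨
      ⟦ (∣ C ∣ ℕₚ.≟ 0) ×-dec size? C ⟧
        ≡⟨ ⟦⟧-cong ((∣ C ∣ ℕₚ.≟ 0) ×-dec size? C) ((n ℕₚ.≟ k) ×-dec (∣ C ∣ ℕₚ.≟ 0))
             (λ { (z , e) → trans (sym e) (cong (ℕ._+ k) z) , z })
             (λ { (e , z) → z , trans (cong (ℕ._+ k) z) (sym e) }) ⟩
      ⟦ (n ℕₚ.≟ k) ×-dec (∣ C ∣ ℕₚ.≟ 0) ⟧
        ≡⟨ ⟦⟧-× (n ℕₚ.≟ k) (∣ C ∣ ℕₚ.≟ 0) ⟩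
      ⟦ n ℕₚ.≟ k ⟧ ℤ.* ⟦ ∣ C ∣ ℕₚ.≟ 0 ⟧ ∎
    pointwise : ∀ C → sum (λ i → ⟦ outer? (Gᵢ i) C ×-dec size? C ⟧) ≡
                      ⟦ outer? G C ×-dec size? C ⟧ ℤ.+ (a ℤ.* ⟦ n ℕₚ.≟ k ⟧) ℤ.* ⟦ ∣ C ∣ ℕₚ.≟ 0 ⟧
    pointwise C = begin
      sum (λ i → ⟦ outer? (Gᵢ i) C ×-dec size? C ⟧)
        ≡⟨ sum-cong-≗ (λ i → ⟦⟧-× (outer? (Gᵢ i) C) (size? C)) ⟩
      sum (λ i → ⟦ outer? (Gᵢ i) C ⟧ ℤ.* ⟦ size? C ⟧)
        ≡⟨ *-distribʳ-sum ⟦ size? C ⟧ (λ i → ⟦ outer? (Gᵢ i) C ⟧) ⟨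
      sum (λ i → ⟦ outer? (Gᵢ i) C ⟧) ℤ.* ⟦ size? C ⟧
        ≡⟨ cong (ℤ._* ⟦ size? C ⟧) (sum-outer C) ⟩
      (⟦ outer? G C ⟧ ℤ.+ a ℤ.* ⟦ ∣ C ∣ ℕₚ.≟ 0 ⟧) ℤ.* ⟦ size? C ⟧
        ≡⟨ expand ⟦ outer? G C ⟧ a ⟦ ∣ C ∣ ℕₚ.≟ 0 ⟧ ⟦ size? C ⟧ ⟩
      ⟦ outer? G C ⟧ ℤ.* ⟦ size? C ⟧ ℤ.+ a ℤ.* (⟦ ∣ C ∣ ℕₚ.≟ 0 ⟧ ℤ.* ⟦ size? C ⟧)
        ≡⟨ cong₂ (λ x y → x ℤ.+ a ℤ.* y) (sym (⟦⟧-× (outer? G C) (size? C))) (swap C) ⟩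
      ⟦ outer? G C ×-dec size? C ⟧ ℤ.+ a ℤ.* (⟦ n ℕₚ.≟ k ⟧ ℤ.* ⟦ ∣ C ∣ ℕₚ.≟ 0 ⟧)
        ≡⟨ cong (ℤ._+_ ⟦ outer? G C ×-dec size? C ⟧) (ℤₚ.*-assoc a ⟦ n ℕₚ.≟ k ⟧ ⟦ ∣ C ∣ ℕₚ.≟ 0 ⟧) ⟨
      ⟦ outer? G C ×-dec size? C ⟧ ℤ.+ (a ℤ.* ⟦ n ℕₚ.≟ k ⟧) ℤ.* ⟦ ∣ C ∣ ℕₚ.≟ 0 ⟧ ∎

theorem2 : ∀ {N m : ℕ} (G : Graph N) (Gᵢ : Fin m → Graph N) → m ≥ 1 → AreComponents G Gᵢ →
    let n = order G
        b = λ (i : Fin m) → n ∸ order (Gᵢ i)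
    in D̃ G ≈ₚ ∑ (tabulate (λ i → 1ℤ X^ b i *ₚ D̃ (Gᵢ i))) -ₚ (+ m ℤ.- 1ℤ) X^ n
theorem2 {m = m} G Gᵢ _ comps k = sym (begin
  coeff (∑ (tabulate shifted) -ₚ a X^ n) k
    ≡⟨ coeff--ₚ (∑ (tabulate shifted)) (a X^ n) k ⟩
  coeff (∑ (tabulate shifted)) k ℤ.- coeff (a X^ n) k
    ≡⟨ cong₂ ℤ._-_ (coeff-∑-tabulate shifted k) (coeff-X^ a n k) ⟩
  sum (λ i → coeff (shifted i) k) ℤ.- a ℤ.* ⟦ n ℕₚ.≟ k ⟧
    ≡⟨ cong (ℤ._- a ℤ.* ⟦ n ℕₚ.≟ k ⟧) (sum-cong-≗ coeff-shifted) ⟩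
  sum (λ i → outerCount (Gᵢ i) n k) ℤ.- a ℤ.* ⟦ n ℕₚ.≟ k ⟧
    ≡⟨ cong (ℤ._- a ℤ.* ⟦ n ℕₚ.≟ k ⟧) (sum-outerCount G Gᵢ comps k) ⟩
  outerCount G n k ℤ.+ a ℤ.* ⟦ n ℕₚ.≟ k ⟧ ℤ.- a ℤ.* ⟦ n ℕₚ.≟ k ⟧
    ≡⟨ cancel (outerCount G n k) (a ℤ.* ⟦ n ℕₚ.≟ k ⟧) ⟩
  outerCount G n k
    ≡⟨ d̃≡outerCount G k ⟨
  + d̃ G k
    ≡⟨ coeff-D̃ G k ⟨
  coeff (D̃ G) k ∎)
  where
  open ≡-Reasoning
  n = order G
  a = + m ℤ.- 1ℤ
  shifted : Fin m → Poly
  shifted i = 1ℤ X^ (n ∸ order (Gᵢ i)) *ₚ D̃ (Gᵢ i)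
  coeff-shifted : ∀ i → coeff (shifted i) k ≡ outerCount (Gᵢ i) n k
  -- A component has at most n vertices, so the truncated difference is exact and the total
  -- `b + order (Gᵢ i)` is n.
  coeff-shifted i = trans (coeff-X^-*ₚ-D̃ (Gᵢ i) (n ∸ order (Gᵢ i)) k)
    (cong (λ l → outerCount (Gᵢ i) l k) (ℕₚ.m∸n+n≡m (p⊆q⇒∣p∣≤∣q∣
      (proj₁ (IsComponent.subgraph (AreComponents.component comps i))))))
  cancel : ∀ x y → x ℤ.+ y ℤ.- y ≡ x
  cancel = solve-∀
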